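{- Let $k\geq 2$ be an integer. Then $ar(3k, kC_{3})=\binom{3k-1}{2}+1$.
   Context: An edge-coloring of a graph assigns a color to each edge; an edge-colored graph is rainbow if all colors on its edges are distinct. For a positive integer $n$ and a graph $F$, the anti-Ramsey number $ar(n,F)$ is the maximum number of colors in an edge-coloring of the complete graph $K_n$ containing no rainbow copy of $F$. $kC_3$ denotes the graph consisting of $k$ vertex-disjoint triangles. -}

module Defs where

open import Data.Nat using (ℕ; _≤_)
open import Data.Fin using (Fin; zero; suc)
open import Data.Product using (Σ; ∃; _×_; _,_)
open import Relation.Binary.PropositionalEquality using (_≡_; _≢_)
open import Relation.Nullary using (¬_)

-- An edge-coloring of the complete graph K_n on vertex set Fin n with
-- colors from Fin m: a symmetric function on pairs of vertices
-- (the value on the diagonal i = i is irrelevant).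
record EdgeColoring (n m : ℕ) : Set where
  field
    col  : Fin n → Fin n → Fin m
    symm : ∀ i j → col i j ≡ col j i

open EdgeColoring public

UsesAllColors : ∀ {n m} → EdgeColoring n m → Set
UsesAllColors {n} {m} c =
  ∀ (a : Fin m) → Σ (Fin n) λ i → Σ (Fin n) λ j → (i ≢ j) × (col c i j ≡ a)

-- A copy of kC_3 (k vertex-disjoint triangles) in K_n: an injective map
-- from the vertex set Fin k × Fin 3 of kC_3 into Fin n.
record kC3Copy (k n : ℕ) : Set where
  field
    emb : Fin k → Fin 3 → Fin n
    inj : ∀ t a t' a' → emb t a ≡ emb t' a' → (t ≡ t') × (a ≡ a')

open kC3Copy public

edgeColor : ∀ {k n m} → EdgeColoring n m → kC3Copy k n → Fin k → Fin 3 → Fin m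
edgeColor c f t zero             = col c (emb f t zero) (emb f t (suc zero))
edgeColor c f t (suc zero)       = col c (emb f t (suc zero)) (emb f t (suc (suc zero)))
edgeColor c f t (suc (suc zero)) = col c (emb f t zero) (emb f t (suc (suc zero)))

IsRainbow : ∀ {k n m} → EdgeColoring n m → kC3Copy k n → Set
IsRainbow c f = ∀ t e t' e' → edgeColor c f t e ≡ edgeColor c f t' e' → (t ≡ t') × (e ≡ e')

NoRainbowkC3 : ∀ {n m} → ℕ → EdgeColoring n m → Set
NoRainbowkC3 {n} k c = ∀ (f : kC3Copy k n) → ¬ IsRainbow c f

Admissible : ℕ → ℕ → ℕ → Set
Admissible k n m = Σ (EdgeColoring n m) λ c → UsesAllColors c × NoRainbowkC3 k c

ArkC3≡ : ℕ → ℕ → ℕ → Set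
ArkC3≡ k n r = Admissible k n r × (∀ m → Admissible k n m → m ≤ r)

{-# OPTIONS --safe #-}
-- Upper bound: choose one representative edge of every colour and let G be the graph of the
-- remaining edges. More than C(n-1,2)+1 colours on n = 3k vertices leave G with at most n-3
-- edges, and a triangle factor avoiding G is rainbow. Such a factor is built greedily: take v
-- of maximum degree in G, then b and c of positive degree as long as vertices not adjacent in
-- G to the previous ones allow it; a third vertex always exists since deg v + deg b ≤ n-3.
-- Either this removes enough edges, or all remaining edges lie between neighbours of v and b
-- and the handshake identity shows that there are few. The only obstructions are cliques
-- K_{k+1} for k = 2, 3; there, changing the representative of one colour removes a clique edge.
-- Lower bound: give all edges at one vertex the same colour and all others distinct colours.
module Submission where

open import Defs
open import Data.Nat using (ℕ; zero; suc; _+_; _*_; _∸_; _≤_; _<_; z≤n; s≤s; s≤s⁻¹; _≟_; _≤?_; _<?_)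
open import Data.Nat.Combinatorics using (_C_; nC1≡n; nCk+nC[k+1]≡[n+1]C[k+1])
open import Data.Nat.Properties
open import Data.Nat.ListAction using (sum)
open import Data.Nat.ListAction.Properties using (sum-↭)
open import Data.Nat.Tactic.RingSolver using (solve-∀)
open import Data.Fin using (Fin; zero; suc; _↑ˡ_; _↑ʳ_; splitAt; punchOut; combine; remQuot)
import Data.Fin.Properties as Fin
open import Data.List using (List; []; _∷_; map; length; _++_; filter; allFin)
open import Data.List.Membership.Propositional using (_∈_)
open import Data.List.Membership.Propositional.Properties using (∈-map⁺; ∈-++⁺ˡ; ∈-++⁺ʳ; ∈-filter⁺; ∈-allFin)
open import Data.List.Membership.Setoid.Properties using (index-injective)
open import Data.List.Properties using (length-map; length-++; length-tabulate)
open import Data.List.Relation.Binary.Permutation.Propositional using (_↭_; refl; prep; swap; trans; ↭-sym; ↭⇒↭ₛ)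
open import Data.List.Relation.Binary.Permutation.Propositional.Properties using (All-resp-↭; ∈-resp-↭; ↭-length; map⁺)
import Data.List.Relation.Binary.Permutation.Setoid.Properties as Permutation
open import Data.List.Relation.Unary.All as All using (All; []; _∷_)
open import Data.List.Relation.Unary.AllPairs using ([]; _∷_)
open import Data.List.Relation.Unary.Any as Any using (here; there)
open import Data.List.Relation.Unary.Unique.Propositional using (Unique)
open import Data.List.Relation.Unary.Unique.Propositional.Properties using (allFin⁺)
open import Data.Product using (Σ; ∃; ∃₂; _×_; _,_; proj₁; proj₂)
open import Data.Sum using (_⊎_; inj₁; inj₂)
open import Function using (_∘_)
open import Relation.Binary.PropositionalEquality using (_≡_; _≢_; refl; sym; cong; cong₂; subst; setoid; module ≡-Reasoning)
  renaming (trans to ≡-trans)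
open import Relation.Nullary using (¬_; Dec; yes; no; contradiction)
open import Relation.Nullary.Decidable using (_×-dec_; _⊎-dec_)
open import Relation.Unary using (Decidable)

-- Selection from lists and sums over lists.

+-exchange : ∀ a b c d → a + b + (c + d) ≡ a + c + (b + d)
+-exchange = solve-∀

-- Vertex sets are lists up to permutation, so a chosen element can be moved to the front and the
-- tail is the set that remains.
pick : {V : Set} {P : V → Set} → Decidable P → ∀ xs →
  (∃₂ λ x ys → xs ↭ x ∷ ys × P x) ⊎ All (¬_ ∘ P) xs
pick P? [] = inj₂ []
pick P? (x ∷ xs) with P? x | pick P? xs
... | yes px | _ = inj₁ (x , xs , refl , px)
... | no _ | inj₁ (y , ys , p , py) = inj₁ (y , x ∷ ys , trans (prep x p) (swap x y refl) , py)
... | no ¬px | inj₂ none = inj₂ (¬px ∷ none)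

pick-max : {V : Set} (f : V → ℕ) → ∀ x xs →
  ∃₂ λ y ys → x ∷ xs ↭ y ∷ ys × All (λ z → f z ≤ f y) ys
pick-max f x [] = x , [] , refl , []
pick-max f x (x′ ∷ xs) with pick-max f x′ xs
... | y , ys , p , max with ≤-total (f x) (f y)
...   | inj₁ fx≤fy = y , x ∷ ys , trans (prep x p) (swap x y refl) , fx≤fy ∷ max
...   | inj₂ fy≤fx = x , x′ ∷ xs , refl ,
          All-resp-↭ (↭-sym p) (fy≤fx ∷ All.map (λ h → ≤-trans h fy≤fx) max)

module _ {V : Set} where

  sum-mono : {f g : V → ℕ} → ∀ {xs} → All (λ x → f x ≤ g x) xs → sum (map f xs) ≤ sum (map g xs)
  sum-mono [] = z≤n
  sum-mono (h ∷ hs) = +-mono-≤ h (sum-mono hs)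

  sum-const : ∀ c (xs : List V) → sum (map (λ _ → c) xs) ≡ c * length xs
  sum-const c [] = sym (*-zeroʳ c)
  sum-const c (x ∷ xs) = ≡-trans (cong (c +_) (sum-const c xs)) (sym (*-suc c (length xs)))

  sum-+ : (f g : V → ℕ) → ∀ xs → sum (map (λ x → f x + g x) xs) ≡ sum (map f xs) + sum (map g xs)
  sum-+ f g [] = refl
  sum-+ f g (x ∷ xs) = ≡-trans (cong (f x + g x +_) (sum-+ f g xs)) (+-exchange (f x) (g x) _ _)

  sum-* : ∀ c (f : V → ℕ) xs → sum (map (λ x → c * f x) xs) ≡ c * sum (map f xs)
  sum-* c f [] = sym (*-zeroʳ c)
  sum-* c f (x ∷ xs) = ≡-trans (cong (c * f x +_) (sum-* c f xs)) (sym (*-distribˡ-+ c (f x) _))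

  length≤sum : {f : V → ℕ} → ∀ {xs} → All (λ x → ¬ f x ≡ 0) xs → length xs ≤ sum (map f xs)
  length≤sum [] = z≤n
  length≤sum (h ∷ hs) = +-mono-≤ (n≢0⇒n>0 h) (length≤sum hs)

-- Graphs, degrees and the handshake identity.

record Graph (V : Set) : Set where
  field
    adj : V → V → ℕ
    adj-sym : ∀ x y → adj x y ≡ adj y x
    adj-irrefl : ∀ x → adj x x ≡ 0
    adj≤1 : ∀ x y → adj x y ≤ 1

-- Parity absorbs an odd excess of one; handshake bounds on `2 * edges` need this slack.
halve-≤ : ∀ {x} y → 2 * x ≤ suc (2 * y) → x ≤ y
halve-≤ {x} y h = s≤s⁻¹ (*-cancelˡ-< 2 x (suc y) (≤-trans (s≤s h) (≤-reflexive (lem y))))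
  where
  lem : ∀ y → suc (suc (2 * y)) ≡ 2 * suc y
  lem = solve-∀

module _ {V : Set} (G : Graph V) where
  open Graph G

  deg : V → List V → ℕ
  deg v ws = sum (map (adj v) ws)

  -- Each edge is counted at whichever of its ends comes first in the list; `edges-↭` shows that the
  -- order does not matter.
  edges : List V → ℕ
  edges [] = 0
  edges (v ∷ vs) = deg v vs + edges vs

  deg-↭ : ∀ v {xs ys} → xs ↭ ys → deg v xs ≡ deg v ys
  deg-↭ v p = sum-↭ (map⁺ (adj v) p)

  edges-↭ : ∀ {xs ys} → xs ↭ ys → edges xs ≡ edges ys
  edges-↭ refl = refl
  edges-↭ (prep x p) = cong₂ _+_ (deg-↭ x p) (edges-↭ p)
  edges-↭ (swap {xs = xs} {ys = ys} x y p)
    rewrite deg-↭ x p | deg-↭ y p | edges-↭ p | adj-sym x y = +-exchange (adj y x) (deg x ys) (deg y ys) _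
  edges-↭ (trans p q) = ≡-trans (edges-↭ p) (edges-↭ q)

  edges-tail : ∀ {vs v us} → vs ↭ v ∷ us → edges us ≤ edges vs
  edges-tail {v = v} {us} p = ≤-trans (m≤n+m _ (deg v us)) (≤-reflexive (sym (edges-↭ p)))

  deg-self : ∀ {v vs us} → vs ↭ v ∷ us → deg v vs ≡ deg v us
  deg-self {v} {us = us} p = ≡-trans (deg-↭ v p) (cong (_+ deg v us) (adj-irrefl v))

  deg-tail : ∀ x {vs v us} → vs ↭ v ∷ us → deg x vs ≡ deg x us + adj v x
  deg-tail x {v = v} {us} p =
    ≡-trans (deg-↭ x p) (≡-trans (+-comm (adj x v) _) (cong (deg x us +_) (adj-sym x v)))

  handshake : ∀ vs → sum (map (λ x → deg x vs) vs) ≡ 2 * edges vs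
  handshake [] = refl
  handshake (v ∷ vs) = begin
    adj v v + deg v vs + sum (map (λ x → adj x v + deg x vs) vs)
      ≡⟨ cong₂ _+_ (cong (_+ deg v vs) (adj-irrefl v)) (sum-+ (λ x → adj x v) (λ x → deg x vs) vs) ⟩
    deg v vs + (sum (map (λ x → adj x v) vs) + sum (map (λ x → deg x vs) vs))
      ≡⟨ cong (deg v vs +_) (cong₂ _+_ (flip vs) (handshake vs)) ⟩
    deg v vs + (deg v vs + 2 * edges vs)
      ≡⟨ lem (deg v vs) (edges vs) ⟩
    2 * (deg v vs + edges vs) ∎
    where
    open ≡-Reasoning
    flip : ∀ ws → sum (map (λ x → adj x v) ws) ≡ deg v ws
    flip [] = refl
    flip (w ∷ ws) = cong₂ _+_ (adj-sym w v) (flip ws)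
    lem : ∀ d e → d + (d + 2 * e) ≡ 2 * (d + e)
    lem = solve-∀

  edges-bound : (f : V → ℕ) → ∀ {vs} → All (λ x → deg x vs ≤ f x) vs → 2 * edges vs ≤ sum (map f vs)
  edges-bound f {vs} h = ≤-trans (≤-reflexive (sym (handshake vs))) (sum-mono h)

  -- Splitting off one triangle that avoids the graph.

  record Step (vs : List V) (r : ℕ) : Set where
    constructor step
    field
      {a b c} : V
      {rest}  : List V
      perm    : vs ↭ a ∷ b ∷ c ∷ rest
      ab      : adj a b ≡ 0
      ac      : adj a c ≡ 0
      bc      : adj b c ≡ 0
      bound   : edges rest ≤ r

  -- If every vertex of `ws` were adjacent to `v` or `b`, then `length ws` would be at most
  -- `deg v ws + deg b ws`, hence at most `edges vs`. That leaves `vs` one vertex short of what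
  -- sparsity demands.
  step-pair : ∀ {vs v b ws r} → 3 + edges vs ≤ length vs → vs ↭ v ∷ b ∷ ws → adj v b ≡ 0 →
    edges ws ≤ r → Step vs r
  step-pair {vs} {v} {b} {ws} sparse p vb≡0 h with pick (λ c → adj v c + adj b c ≟ 0) ws
  ... | inj₁ (c , ws′ , q , c≡0) =
        step (trans p (prep v (prep b q))) vb≡0 (m+n≡0⇒m≡0 (adj v c) c≡0) (m+n≡0⇒n≡0 (adj v c) c≡0)
          (≤-trans (edges-tail q) h)
  ... | inj₂ none = contradiction (≤-trans sparse few) (<⇒≱ (n<1+n _))
    where
    open ≤-Reasoning
    few : length vs ≤ 2 + edges vs
    few = begin
      length vs                             ≡⟨ ↭-length p ⟩
      2 + length ws                         ≤⟨ +-monoʳ-≤ 2 (length≤sum none) ⟩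
      2 + sum (map (λ c → adj v c + adj b c) ws) ≡⟨ cong (2 +_) (sum-+ (adj v) (adj b) ws) ⟩
      2 + (deg v ws + deg b ws)             ≤⟨ +-monoʳ-≤ 2 (+-mono-≤ (m≤n+m _ (adj v b)) (m≤m+n _ (edges ws))) ⟩
      2 + edges (v ∷ b ∷ ws)                ≡⟨ cong (2 +_) (sym (edges-↭ p)) ⟩
      2 + edges vs                          ∎

  step-one : ∀ {vs v us r} → 3 + edges vs ≤ length vs → vs ↭ v ∷ us → edges us ≤ r → Step vs r
  step-one {vs} {v} {us} sparse p h with pick (λ b → adj v b ≟ 0) us
  ... | inj₁ (b , ws , q , vb≡0) = step-pair sparse (trans p (prep v q)) vb≡0 (≤-trans (edges-tail q) h)
  ... | inj₂ none = contradiction (≤-trans sparse few) (<⇒≱ (m≤n+m _ 1))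
    where
    open ≤-Reasoning
    few : length vs ≤ 1 + edges vs
    few = begin
      length vs          ≡⟨ ↭-length p ⟩
      1 + length us      ≤⟨ +-monoʳ-≤ 1 (length≤sum none) ⟩
      1 + deg v us       ≤⟨ +-monoʳ-≤ 1 (m≤m+n _ (edges us)) ⟩
      1 + edges (v ∷ us) ≡⟨ cong (1 +_) (sym (edges-↭ p)) ⟩
      1 + edges vs       ∎

  -- `S x` counts the vertices already chosen that are adjacent to `x`. A free vertex can join them
  -- and still takes an edge of `ws` away.
  Free : (V → ℕ) → List V → Set
  Free S ws = ∃₂ λ c ws′ → ws ↭ c ∷ ws′ × S c ≡ 0 × 1 ≤ deg c ws′

  Heavy : (V → ℕ) → ℕ → List V → Set
  Heavy S t ws = ∃₂ λ x ws′ → ws ↭ x ∷ ws′ × 1 ≤ S x × t < deg x ws′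

  Covered : (V → ℕ) → List V → Set
  Covered S ws = All (λ x → S x ≡ 0 → deg x ws ≡ 0) ws

  -- Without free vertices, `S x ≡ 0` forces degree zero; without heavy ones, every other degree is
  -- at most `t`. So each degree is at most `t * S x`, and the handshake identity sums this.
  trichotomy : ∀ S t ws →
    Free S ws ⊎ (Covered S ws × (Heavy S t ws ⊎ 2 * edges ws ≤ t * sum (map S ws)))
  trichotomy S t ws with pick (λ c → (S c ≟ 0) ×-dec (1 ≤? deg c ws)) ws
  ... | inj₁ (c , ws′ , q , Sc , d) = inj₁ (c , ws′ , q , Sc , subst (1 ≤_) (deg-self q) d)
  ... | inj₂ noFree = inj₂ (covered , rest)
    where
    covered : Covered S ws
    covered = All.map (λ h Sx≡0 → n<1⇒n≡0 (≰⇒> (λ d → h (Sx≡0 , d)))) noFree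
    degree-bound : ∀ {x} → (S x ≡ 0 → deg x ws ≡ 0) × ¬ (1 ≤ S x × t < deg x ws) → deg x ws ≤ t * S x
    degree-bound {x} (z , h) with S x
    ... | zero  = ≤-trans (≤-reflexive (z refl)) z≤n
    ... | suc s = ≤-trans (≮⇒≥ (λ d → h (s≤s z≤n , d))) (m≤m*n t (suc s))
    rest : Heavy S t ws ⊎ 2 * edges ws ≤ t * sum (map S ws)
    rest with pick (λ x → (1 ≤? S x) ×-dec (t <? deg x ws)) ws
    ... | inj₁ (x , ws′ , q , Sx , d) = inj₁ (x , ws′ , q , Sx , subst (t <_) (deg-self q) d)
    ... | inj₂ noHeavy = inj₂ (≤-trans
            (edges-bound (λ x → t * S x) (All.zipWith degree-bound (covered , noHeavy)))
            (≤-reflexive (sum-* t S ws)))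

  -- A heavy vertex would have degree above `t` and weight at least one, exceeding the assumed bound
  -- `suc t`.
  dichotomy : ∀ S t ws → All (λ x → deg x ws + S x ≤ suc t) ws →
    Free S ws ⊎ 2 * edges ws ≤ t * sum (map S ws)
  dichotomy S t ws max with trichotomy S t ws
  ... | inj₁ free = inj₁ free
  ... | inj₂ (_ , inj₂ h) = inj₂ h
  ... | inj₂ (_ , inj₁ (x , ws′ , q , Sx , d)) = contradiction (≤-trans big small) (<⇒≱ (n<1+n _))
    where
    small : deg x ws + S x ≤ suc t
    small = All.head (All-resp-↭ q max)
    big : suc (suc t) ≤ deg x ws + S x
    big = ≤-trans (≤-reflexive (+-comm 1 (suc t))) (+-mono-≤ (subst (t <_) (sym (deg-self q)) d) Sx)

  -- Greedy rounds from a vertex of maximum degree.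

  IsMax : V → List V → Set
  IsMax v us = All (λ y → deg y us + adj v y ≤ deg v us) us

  max-vertex : ∀ vs → 1 ≤ length vs → ∃₂ λ v us → vs ↭ v ∷ us × IsMax v us
  max-vertex vs@(x ∷ xs) _ with pick-max (λ y → deg y vs) x xs
  ... | v , us , p , max =
        v , us , p , All.map (λ {y} h → subst (_≤ deg v us) (deg-tail y p) (≤-trans h (≤-reflexive (deg-self p)))) max

  max-edges : ∀ {v us} → IsMax v us → 2 * edges us ≤ deg v us * length us
  max-edges {v} {us} max =
    ≤-trans (edges-bound (λ _ → deg v us) (All.map (≤-trans (m≤m+n _ _)) max)) (≤-reflexive (sum-const (deg v us) us))

  max-0 : ∀ {v us} → IsMax v us → deg v us ≡ 0 → edges us ≤ 0
  max-0 {us = us} max dv =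
    halve-≤ 0 (≤-trans (max-edges max) (≤-trans (≤-reflexive (cong (_* length us) dv)) z≤n))

  -- If no free vertex exists for `v`, the edges left are bounded through `single`, unless some
  -- neighbour of `v` is heavy. A free `b` removes one more edge, which suffices when
  -- `edges us ≤ 1 + r`. Otherwise a free `c` removes a second one, or all remaining edges are
  -- covered by neighbours of `v` and `b`, which leaves at most `t * suc t` of them.
  greedy : ∀ s {t vs v us r} → 3 + edges vs ≤ length vs → vs ↭ v ∷ us → IsMax v us →
    deg v us ≡ suc t → s * suc t ≤ suc (2 * r) →
    edges us ≤ 2 + r → edges us ≤ 1 + r ⊎ t * suc t ≤ r →
    Step vs r ⊎ (Covered (adj v) us × Heavy (adj v) s us)
  greedy s {t} {vs} {v} {us} {r} sparse p max dv single few2 few1 with trichotomy (adj v) s us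
  ... | inj₂ (cov , inj₁ heavy) = inj₂ (cov , heavy)
  ... | inj₂ (_ , inj₂ h) =
        inj₁ (step-one sparse p (halve-≤ r (≤-trans h (≤-trans (≤-reflexive (cong (s *_) dv)) single))))
  ... | inj₁ (b , ws , q , vb≡0 , db) = inj₁ (go few1)
    where
    pb : vs ↭ v ∷ b ∷ ws
    pb = trans p (prep v q)
    S : V → ℕ
    S x = adj v x + adj b x
    drop : ∀ {k} → edges us ≤ suc k → edges ws ≤ k
    drop h = s≤s⁻¹ (≤-trans (+-mono-≤ db ≤-refl) (≤-trans (≤-reflexive (sym (edges-↭ q))) h))
    max-us : All (λ x → deg x us + adj v x ≤ suc t) (b ∷ ws)
    max-us = All-resp-↭ q (subst (λ d → All (λ y → deg y us + adj v y ≤ d) us) dv max)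
    -- The adjacency to `b` lost in passing from `us` to `ws` reappears in `S`, so the
    -- maximum-degree bound survives.
    max-ws : All (λ x → deg x ws + S x ≤ suc t) ws
    max-ws = All.map (λ {x} h → ≤-trans (≤-reflexive (re x)) h) (All.tail max-us)
      where
      lem : ∀ a b c → a + (b + c) ≡ a + c + b
      lem = solve-∀
      re : ∀ x → deg x ws + S x ≡ deg x us + adj v x
      re x = ≡-trans (lem (deg x ws) (adj v x) (adj b x)) (cong (_+ adj v x) (sym (deg-tail x q)))
    go : edges us ≤ 1 + r ⊎ t * suc t ≤ r → Step vs r
    go (inj₁ h) = step-pair sparse pb vb≡0 (drop h)
    go (inj₂ h) with dichotomy S t ws max-ws
    ... | inj₁ (c , ws′ , q′ , Sc , dc) =
          step (trans pb (prep v (prep b q′))) vb≡0 (m+n≡0⇒m≡0 (adj v c) Sc) (m+n≡0⇒n≡0 (adj v c) Sc)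
            (s≤s⁻¹ (≤-trans (+-mono-≤ dc ≤-refl) (≤-trans (≤-reflexive (sym (edges-↭ q′))) (drop few2))))
    ... | inj₂ 2e≤ = step-pair sparse pb vb≡0 (≤-trans (*-cancelˡ-≤ 2 (≤-trans 2e≤ twice)) h)
      where
      open ≤-Reasoning
      lem : ∀ t → t * (suc t + suc t) ≡ 2 * (t * suc t)
      lem = solve-∀
      dv≤ : deg v ws ≤ suc t
      dv≤ = ≤-trans (m≤n+m _ (adj v b)) (≤-reflexive (≡-trans (sym (deg-↭ v q)) dv))
      db≤ : deg b ws ≤ suc t
      db≤ = ≤-trans (≤-reflexive (sym (deg-self q))) (≤-trans (m≤m+n _ _) (All.head max-us))
      twice : t * sum (map S ws) ≤ 2 * (t * suc t)
      twice = begin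
        t * sum (map S ws)         ≡⟨ cong (t *_) (sum-+ (adj v) (adj b) ws) ⟩
        t * (deg v ws + deg b ws)  ≤⟨ *-monoʳ-≤ t (+-mono-≤ dv≤ db≤) ⟩
        t * (suc t + suc t)        ≡⟨ lem t ⟩
        2 * (t * suc t)            ∎

  -- For `s = t` the heavy case is void: a neighbour of `v` with degree above `t` in `us` would beat
  -- the maximum degree `suc t`.
  greedy-max : ∀ {t vs v us r} → 3 + edges vs ≤ length vs → vs ↭ v ∷ us → IsMax v us →
    deg v us ≡ suc t → t * suc t ≤ suc (2 * r) →
    edges us ≤ 2 + r → edges us ≤ 1 + r ⊎ t * suc t ≤ r → Step vs r
  greedy-max {t} {v = v} {us} sparse p max dv single few2 few1 with greedy t sparse p max dv single few2 few1
  ... | inj₁ st = st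
  ... | inj₂ (_ , x , ws , q , vx , dx) = contradiction (≤-trans big small) (<⇒≱ (n<1+n _))
    where
    small : deg x us + adj v x ≤ suc t
    small = ≤-trans (All.head (All-resp-↭ q max)) (≤-reflexive dv)
    big : suc (suc t) ≤ deg x us + adj v x
    big = ≤-trans (≤-reflexive (+-comm 1 (suc t))) (+-mono-≤ (subst (t <_) (sym (deg-self q)) dx) vx)

  -- Rounds for given edge budgets.

  edges-rest : ∀ {vs v us} d {r} → vs ↭ v ∷ us → d ≤ deg v us → edges vs ≤ d + r → edges us ≤ r
  edges-rest d p dv h = +-cancelˡ-≤ d _ _ (≤-trans (+-monoˡ-≤ _ dv) (≤-trans (≤-reflexive (sym (edges-↭ p))) h))

  -- The triangle must meet three edges, or the rest must be within budget anyway. Degree three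
  -- settles it with `v` alone; degree two leaves one edge for `b`, degree one leaves two for `b`
  -- and `c`.
  step-covering-3 : ∀ {vs} r → 3 + edges vs ≤ length vs → edges vs ≤ 4 + r → Step vs (1 + r)
  step-covering-3 {vs} r sparse few with max-vertex vs (≤-trans (s≤s z≤n) sparse)
  ... | v , us , p , max = cases (deg v us) refl
    where
    cases : ∀ d → deg v us ≡ d → Step vs (1 + r)
    cases 0 dv = step-one sparse p (≤-trans (max-0 max dv) z≤n)
    cases 1 dv = greedy-max sparse p max dv z≤n (edges-rest 1 p (≤-reflexive (sym dv)) few) (inj₂ z≤n)
    cases 2 dv = greedy-max sparse p max dv (s≤s (≤-trans (s≤s z≤n) (m≤m+n (1 + r) _))) (m≤n⇒m≤1+n h) (inj₁ h)
      where h = edges-rest 2 p (≤-reflexive (sym dv)) few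
    cases (suc (suc (suc d))) dv = step-one sparse p (edges-rest 3 p (≤-trans (m≤m+n 3 d) (≤-reflexive (sym dv))) few)

  -- The numbers in such names are the edge budgets before and after the round.
  step-2-0 : ∀ {vs} → 3 + edges vs ≤ length vs → edges vs ≤ 2 → Step vs 0
  step-2-0 {vs} sparse few with max-vertex vs (≤-trans (s≤s z≤n) sparse)
  ... | v , us , p , max = cases (deg v us) refl
    where
    cases : ∀ d → deg v us ≡ d → Step vs 0
    cases 0 dv = step-one sparse p (max-0 max dv)
    cases 1 dv = greedy-max sparse p max dv z≤n (m≤n⇒m≤1+n (edges-rest 1 p (≤-reflexive (sym dv)) few)) (inj₂ z≤n)
    cases (suc (suc d)) dv = step-one sparse p (edges-rest 2 p (≤-trans (m≤m+n 2 d) (≤-reflexive (sym dv))) few)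

  -- Here four edges have to go, because the nine vertices that remain tolerate only five edges:
  -- `K_4` has six.
  step-9-5 : ∀ {vs} → length vs ≡ 12 → 3 + edges vs ≤ length vs → edges vs ≤ 9 → Step vs 5
  step-9-5 {vs} len sparse few with max-vertex vs (≤-trans (s≤s z≤n) sparse)
  ... | v , us , p , max = cases (deg v us) refl
    where
    len-us : length us ≡ 11
    len-us = suc-injective (≡-trans (sym (↭-length p)) len)
    bound : ∀ {d} → deg v us ≡ d → 2 * edges us ≤ d * 11
    bound dv = ≤-trans (max-edges max) (≤-reflexive (cong₂ _*_ dv len-us))
    cases : ∀ d → deg v us ≡ d → Step vs 5
    cases 0 dv = step-one sparse p (halve-≤ 5 (≤-trans (bound dv) z≤n))
    -- Eleven remaining vertices of degree at most one: `2 * edges us ≤ 11` gives at most five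
    -- edges.
    cases 1 dv = step-one sparse p (halve-≤ 5 (bound dv))
    cases 2 dv = greedy-max sparse p max dv (≤ᵇ⇒≤ _ _ _) (edges-rest 2 p (≤-reflexive (sym dv)) few) (inj₂ (≤ᵇ⇒≤ _ _ _))
    cases 3 dv = greedy-max sparse p max dv (≤ᵇ⇒≤ _ _ _) (m≤n⇒m≤1+n h) (inj₁ h)
      where h = edges-rest 3 p (≤-reflexive (sym dv)) few
    cases (suc (suc (suc (suc d)))) dv = step-one sparse p (edges-rest 4 p (≤-trans (m≤m+n 4 d) (≤-reflexive (sym dv))) few)

  -- The exceptional cliques on six and nine vertices.

  TriangleIn : List V → Set
  TriangleIn vs = ∃₂ λ v a → ∃₂ λ x ys →
    vs ↭ v ∷ a ∷ x ∷ ys × 1 ≤ adj v a × 1 ≤ adj v x × 1 ≤ adj a x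

  -- This is all that is kept of the exceptional `K_4`: once `v a` is freed, removing its ends still
  -- removes four edges.
  HeavyEdgeIn : List V → Set
  HeavyEdgeIn vs = ∃₂ λ v a → ∃ λ ws →
    vs ↭ v ∷ a ∷ ws × 1 ≤ adj v a × 2 ≤ deg v ws × 2 ≤ deg a ws

  neighbour : ∀ {a ws} → 1 ≤ deg a ws → ∃₂ λ x ys → ws ↭ x ∷ ys × 1 ≤ adj a x
  neighbour {a} {ws} d with pick (λ x → 1 ≤? adj a x) ws
  ... | inj₁ found = found
  ... | inj₂ none = contradiction (≤-trans d zero-sum) λ ()
    where
    zero-sum : deg a ws ≤ 0
    zero-sum = ≤-trans (sum-mono (All.map (s≤s⁻¹ ∘ ≰⇒>) none)) (≤-reflexive (sum-const 0 ws))

  -- The round fails only if `v` has degree two and a neighbour `a` with a further edge `a x`.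
  -- Coverage then makes `x` adjacent to `v`, which closes a triangle.
  step-3-0 : ∀ {vs} → 3 + edges vs ≤ length vs → edges vs ≤ 3 → Step vs 0 ⊎ TriangleIn vs
  step-3-0 {vs} sparse few with max-vertex vs (≤-trans (s≤s z≤n) sparse)
  ... | v , us , p , max = cases (deg v us) refl
    where
    triangle : Covered (adj v) us × Heavy (adj v) 0 us → TriangleIn vs
    triangle (cov , a , ws , q , va , da) with neighbour {a} {ws} da
    ... | x , ys , q′ , ax =
          v , a , x , ys , trans p (prep v (trans q (prep a q′))) , va , n≢0⇒n>0 (λ vx≡0 →
            contradiction (≤-trans ax (≤-trans (≤-trans (m≤n+m _ (deg x ws)) (≤-reflexive (sym (deg-tail x q))))
              (≤-reflexive (covx vx≡0)))) λ ()) , ax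
      where
      covx : adj v x ≡ 0 → deg x us ≡ 0
      covx = All.head (All.tail (All-resp-↭ (trans q (prep a q′)) cov))
    cases : ∀ d → deg v us ≡ d → Step vs 0 ⊎ TriangleIn vs
    cases 0 dv = inj₁ (step-one sparse p (max-0 max dv))
    cases 1 dv = inj₁ (greedy-max sparse p max dv z≤n (edges-rest 1 p (≤-reflexive (sym dv)) few) (inj₂ z≤n))
    cases 2 dv with greedy 0 sparse p max dv z≤n (m≤n⇒m≤1+n (edges-rest 2 p (≤-reflexive (sym dv)) few)) (inj₁ (edges-rest 2 p (≤-reflexive (sym dv)) few))
    ... | inj₁ st = inj₁ st
    ... | inj₂ exc = inj₂ (triangle exc)
    cases (suc (suc (suc d))) dv = inj₁ (step-one sparse p (edges-rest 3 p (≤-trans (m≤m+n 3 d) (≤-reflexive (sym dv))) few))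

  step-6-2 : ∀ {vs} → length vs ≡ 9 → 3 + edges vs ≤ length vs → edges vs ≤ 6 → Step vs 2 ⊎ HeavyEdgeIn vs
  step-6-2 {vs} len sparse few with max-vertex vs (≤-trans (s≤s z≤n) sparse)
  ... | v , us , p , max = cases (deg v us) refl
    where
    -- A matching on nine vertices: one edge at `v` and at most four among the other eight. With
    -- five edges, removing three is enough.
    few-edges : ∀ {d} → deg v us ≡ d → d ≤ 1 → edges vs ≤ 5
    few-edges {d} dv d≤1 = ≤-trans (≤-reflexive (edges-↭ p)) (+-mono-≤ (≤-trans (≤-reflexive dv) d≤1)
      (halve-≤ 4 (≤-trans (max-edges max) (≤-trans (*-mono-≤ (≤-trans (≤-reflexive dv) d≤1)
        (≤-reflexive (suc-injective (≡-trans (sym (↭-length p)) len)))) (n≤1+n 8)))))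
    heavy-edge : deg v us ≡ 3 → Heavy (adj v) 1 us → HeavyEdgeIn vs
    heavy-edge dv (a , ws , q , va , da) = v , a , ws , trans p (prep v q) , va ,
      s≤s⁻¹ (≤-trans (≤-reflexive (≡-trans (sym dv) (deg-↭ v q))) (+-monoˡ-≤ (deg v ws) (adj≤1 v a))) , da
    cases : ∀ d → deg v us ≡ d → Step vs 2 ⊎ HeavyEdgeIn vs
    cases 0 dv = inj₁ (step-covering-3 1 sparse (few-edges dv z≤n))
    cases 1 dv = inj₁ (step-covering-3 1 sparse (few-edges dv ≤-refl))
    cases 2 dv = inj₁ (greedy-max sparse p max dv (≤ᵇ⇒≤ _ _ _) (edges-rest 2 p (≤-reflexive (sym dv)) few) (inj₂ ≤-refl))
    -- The choice `s = 2` would need `2 * 3 ≤ 5`, which is what `K_4` violates; with `s = 1` a heavy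
    -- neighbour of `v` is reported instead.
    cases 3 dv with greedy 1 sparse p max dv (≤ᵇ⇒≤ _ _ _) (m≤n⇒m≤1+n (edges-rest 3 p (≤-reflexive (sym dv)) few)) (inj₁ (edges-rest 3 p (≤-reflexive (sym dv)) few))
    ... | inj₁ st = inj₁ st
    ... | inj₂ (_ , heavy) = inj₂ (heavy-edge dv heavy)
    cases (suc (suc (suc (suc d)))) dv = inj₁ (step-one sparse p (edges-rest 4 p (≤-trans (m≤m+n 4 d) (≤-reflexive (sym dv))) few))

  step-opened-heavy-edge : ∀ {vs v a ws} → 3 + edges vs ≤ length vs → edges vs ≤ 6 →
    vs ↭ v ∷ a ∷ ws → adj v a ≡ 0 → 2 ≤ deg v ws → 2 ≤ deg a ws → Step vs 2
  step-opened-heavy-edge {vs} {v} {a} {ws} sparse few p va≡0 dv da =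
    step-pair sparse p va≡0 (+-cancelˡ-≤ 4 _ _ (begin
      2 + 2 + edges ws                        ≤⟨ +-monoˡ-≤ _ (+-mono-≤ dv da) ⟩
      deg v ws + deg a ws + edges ws          ≡⟨ +-assoc (deg v ws) _ _ ⟩
      deg v ws + (deg a ws + edges ws)        ≤⟨ +-monoˡ-≤ _ (m≤n+m _ (adj v a)) ⟩
      edges (v ∷ a ∷ ws)                      ≡⟨ sym (edges-↭ p) ⟩
      edges vs                                ≤⟨ few ⟩
      6                                       ∎))
    where open ≤-Reasoning

  -- With zero weights no vertex can be heavy, and without a free vertex there are no edges at all.
  endpoint : ∀ {ws} → 1 ≤ edges ws → ∃₂ λ c ws′ → ws ↭ c ∷ ws′ × 1 ≤ deg c ws′
  endpoint {ws} h with trichotomy (λ _ → 0) 0 ws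
  ... | inj₁ (c , ws′ , q , _ , dc) = c , ws′ , q , dc
  ... | inj₂ (_ , inj₂ none) = contradiction (≤-trans h (halve-≤ 0 (m≤n⇒m≤1+n none))) λ ()

  -- Besides `v x` and `a x` at most one edge remains. If it lies inside `ys`, one of its ends
  -- completes `v` and `a`; if it joins `x` to `ys`, then `x` meets every edge; otherwise `v` and
  -- `a` meet every edge.
  step-opened-triangle : ∀ {vs v a x ys} → 3 + edges vs ≤ length vs → edges vs ≤ 3 →
    vs ↭ v ∷ a ∷ x ∷ ys → adj v a ≡ 0 → 1 ≤ adj v x → 1 ≤ adj a x → Step vs 0
  step-opened-triangle {vs} {v} {a} {x} {ys} sparse few p va≡0 vx ax =
    cases (edges ys) (deg x ys) refl refl
    where
    open ≤-Reasoning
    lem : ∀ v a x e → 2 + (v + a + (x + e)) ≡ suc v + (suc a + (x + e))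
    lem = solve-∀
    total : deg v ys + deg a ys + (deg x ys + edges ys) ≤ 1
    total = +-cancelˡ-≤ 2 _ _ (begin
      2 + (deg v ys + deg a ys + (deg x ys + edges ys))   ≡⟨ lem (deg v ys) (deg a ys) (deg x ys) (edges ys) ⟩
      suc (deg v ys) + (suc (deg a ys) + (deg x ys + edges ys))
        ≤⟨ +-mono-≤ (+-monoˡ-≤ _ vx) (+-monoˡ-≤ _ (+-monoˡ-≤ _ ax)) ⟩
      (adj v x + deg v ys) + ((adj a x + deg a ys) + (deg x ys + edges ys))
        ≤⟨ +-monoˡ-≤ _ (m≤n+m _ (adj v a)) ⟩
      edges (v ∷ a ∷ x ∷ ys)                              ≡⟨ sym (edges-↭ p) ⟩
      edges vs                                            ≤⟨ few ⟩
      3                                                   ∎)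
    none : 1 ≤ deg x ys + edges ys → deg v ys + deg a ys ≡ 0
    none h = n≤0⇒n≡0 (+-cancelʳ-≤ 1 _ 0 (≤-trans (+-monoʳ-≤ (deg v ys + deg a ys) h) total))
    cases : ∀ e d → edges ys ≡ e → deg x ys ≡ d → Step vs 0
    cases zero zero e≡ d≡ = step-pair sparse p va≡0 (≤-reflexive (cong₂ _+_ d≡ e≡))
    cases zero (suc d) e≡ d≡ = step-one sparse
      (trans p (trans (prep v (swap a x refl)) (swap v x refl)))
      (≤-reflexive (cong₂ _+_ (cong₂ _+_ va≡0 (m+n≡0⇒m≡0 _ nn)) (cong₂ _+_ (m+n≡0⇒n≡0 (deg v ys) nn) e≡)))
      where
      nn : deg v ys + deg a ys ≡ 0
      nn = none (≤-trans (s≤s z≤n) (≤-trans (≤-reflexive (sym d≡)) (m≤m+n _ (edges ys))))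
    cases (suc e) d e≡ d≡ with endpoint (≤-trans (s≤s z≤n) (≤-reflexive (sym e≡)))
    ... | c , ys′ , q , dc = step
      (trans p (prep v (prep a (trans (prep x q) (swap x c refl))))) va≡0
      (avoid v (m+n≡0⇒m≡0 _ nn)) (avoid a (m+n≡0⇒n≡0 (deg v ys) nn))
      (+-cancelʳ-≤ 1 _ _ (begin
        deg x ys′ + edges ys′ + 1     ≡⟨ +-assoc (deg x ys′) _ 1 ⟩
        deg x ys′ + (edges ys′ + 1)   ≤⟨ +-mono-≤ (≤-trans (m≤n+m _ (adj x c)) (≤-reflexive (sym (deg-↭ x q))))
                                           (≤-trans (≤-reflexive (+-comm _ 1)) (≤-trans (+-monoˡ-≤ _ dc) (≤-reflexive (sym (edges-↭ q))))) ⟩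
        deg x ys + edges ys           ≤⟨ m≤n+m _ (deg v ys + deg a ys) ⟩
        deg v ys + deg a ys + (deg x ys + edges ys) ≤⟨ total ⟩
        1                             ∎))
      where
      nn : deg v ys + deg a ys ≡ 0
      nn = none (≤-trans (≤-trans (s≤s z≤n) (≤-reflexive (sym e≡))) (m≤n+m _ (deg x ys)))
      avoid : ∀ w → deg w ys ≡ 0 → adj w c ≡ 0
      avoid w h = m+n≡0⇒m≡0 _ (≡-trans (sym (deg-↭ w q)) h)

  -- Triangle factors by iterated rounds.

  data Factor : List V → Set where
    []  : Factor []
    tri : ∀ {vs a b c ws} → vs ↭ a ∷ b ∷ c ∷ ws →
          adj a b ≡ 0 → adj a c ≡ 0 → adj b c ≡ 0 → Factor ws → Factor vs

  extend : ∀ {vs r n} → Step vs r → length vs ≡ 3 + n →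
    (∀ {ws} → length ws ≡ n → edges ws ≤ r → Factor ws) → Factor vs
  extend (step perm ab ac bc bound) len f =
    tri perm ab ac bc (f (+-cancelˡ-≡ 3 _ _ (≡-trans (sym (↭-length perm)) len)) bound)

  sparse-from : ∀ vs r → length vs ≡ 3 + r → edges vs ≤ r → 3 + edges vs ≤ length vs
  sparse-from vs r len h = ≤-trans (+-monoʳ-≤ 3 h) (≤-reflexive (sym len))

  factor-0 : ∀ {vs} → length vs ≡ 0 → Factor vs
  factor-0 {[]} _ = []

  factor-3 : ∀ {vs} → length vs ≡ 3 → edges vs ≤ 0 → Factor vs
  factor-3 {v ∷ us} len few =
    extend (step-one (sparse-from (v ∷ us) 0 len few) refl (≤-trans (m≤n+m _ (deg v us)) few)) len (λ l _ → factor-0 l)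

  -- For six and nine vertices the budget is one below `n - 3`, since `K_3` and `K_4` have exactly
  -- `n - 3` edges and admit no factor.
  factor-6 : ∀ {vs} → length vs ≡ 6 → edges vs ≤ 2 → Factor vs
  factor-6 {vs} len few = extend (step-2-0 (sparse-from vs 3 len (m≤n⇒m≤1+n few)) few) len factor-3

  factor-9 : ∀ {vs} → length vs ≡ 9 → edges vs ≤ 5 → Factor vs
  factor-9 {vs} len few = extend (step-covering-3 1 (sparse-from vs 6 len (m≤n⇒m≤1+n few)) few) len factor-6

  -- From twelve vertices on, the full budget `n - 3` works: it drops by three per round, and only
  -- the round from twelve to nine has to remove four edges.
  factor-≥12 : ∀ j {vs} → length vs ≡ 12 + j * 3 → edges vs ≤ 9 + j * 3 → Factor vs
  factor-≥12 zero {vs} len few = extend (step-9-5 len (sparse-from vs 9 len few) few) len factor-9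
  factor-≥12 (suc j) {vs} len few =
    extend (step-covering-3 (8 + j * 3) (sparse-from vs (12 + j * 3) len few) few) len (factor-≥12 j)

  factor-or-exception : ∀ k {vs} → length vs ≡ 6 + k * 3 → edges vs ≤ 3 + k * 3 →
    Factor vs ⊎ (k ≡ 0 × TriangleIn vs) ⊎ (k ≡ 1 × HeavyEdgeIn vs)
  factor-or-exception 0 {vs} len few with step-3-0 (sparse-from vs 3 len few) few
  ... | inj₁ st = inj₁ (extend st len factor-3)
  ... | inj₂ t = inj₂ (inj₁ (refl , t))
  factor-or-exception 1 {vs} len few with step-6-2 len (sparse-from vs 6 len few) few
  ... | inj₁ st = inj₁ (extend st len factor-6)
  ... | inj₂ h = inj₂ (inj₂ (refl , h))
  factor-or-exception (suc (suc k)) len few = inj₁ (factor-≥12 k len few)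

-- Counting the pairs that are not edges.

SamePair : {V : Set} → V → V → V → V → Set
SamePair i j x y = (i ≡ x × j ≡ y) ⊎ (i ≡ y × j ≡ x)

off : {A : Set} → Dec A → ℕ
off (yes _) = 0
off (no _)  = 1

off-yes : {A : Set} (d : Dec A) → A → off d ≡ 0
off-yes (yes _) _ = refl
off-yes (no ¬a) a = contradiction a ¬a

off≡0 : {A : Set} (d : Dec A) → off d ≡ 0 → A
off≡0 (yes a) _ = a

off≤1 : {A : Set} (d : Dec A) → off d ≤ 1
off≤1 (yes _) = z≤n
off≤1 (no _)  = ≤-refl

off-mono : {A B : Set} (d : Dec A) (d′ : Dec B) → (B → A) → off d ≤ off d′
off-mono (yes _) _       _ = z≤n
off-mono (no ¬a) (yes b) f = contradiction (f b) ¬a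
off-mono (no _)  (no _)  _ = ≤-refl

-- This is `n C 2`, in the recursion that matches `edges` and `nulls`.
choose2 : ℕ → ℕ
choose2 0 = 0
choose2 (suc n) = n + choose2 n

module _ {V : Set} {Null : V → V → Set} (null? : ∀ x y → Dec (Null x y)) where

  nulls : List V → List (V × V)
  nulls [] = []
  nulls (v ∷ vs) = map (v ,_) (filter (null? v) vs) ++ nulls vs

  length-filter+sum : ∀ v vs → length (filter (null? v) vs) + sum (map (λ x → off (null? v x)) vs) ≡ length vs
  length-filter+sum v [] = refl
  length-filter+sum v (x ∷ vs) with null? v x
  ... | yes _ = cong suc (length-filter+sum v vs)
  ... | no _  = ≡-trans (+-suc (length (filter (null? v) vs)) _) (cong suc (length-filter+sum v vs))

  ∈-nulls : (∀ {x y} → Null x y → Null y x) → ∀ {x y vs} → x ∈ vs → y ∈ vs → x ≢ y → Null x y →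
    ∃₂ λ i j → (i , j) ∈ nulls vs × SamePair i j x y
  ∈-nulls null-sym (here refl) (here refl) x≢y _ = contradiction refl x≢y
  ∈-nulls null-sym {x} {y} (here refl) (there y∈) x≢y h =
    x , y , ∈-++⁺ˡ (∈-map⁺ (x ,_) (∈-filter⁺ (null? x) y∈ h)) , inj₁ (refl , refl)
  ∈-nulls null-sym {x} {y} (there x∈) (here refl) x≢y h =
    y , x , ∈-++⁺ˡ (∈-map⁺ (y ,_) (∈-filter⁺ (null? y) x∈ (null-sym h))) , inj₂ (refl , refl)
  ∈-nulls null-sym {vs = v ∷ vs} (there x∈) (there y∈) x≢y h with ∈-nulls null-sym x∈ y∈ x≢y h
  ... | i , j , ij∈ , same = i , j , ∈-++⁺ʳ (map (v ,_) (filter (null? v) vs)) ij∈ , same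

-- From a factor to an indexed family of disjoint triangles.

Unique-↭ : {V : Set} {xs ys : List V} → xs ↭ ys → Unique xs → Unique ys
Unique-↭ {V} p = Permutation.Unique-resp-↭ (setoid V) (↭⇒↭ₛ p)

pattern 0F = zero
pattern 1F = suc zero
pattern 2F = suc (suc zero)

triple : {V : Set} → V → V → V → Fin 3 → V
triple a b c 0F = a
triple a b c 1F = b
triple a b c 2F = c

triple-∈ : {V : Set} (a b c : V) {ws : List V} → ∀ i → triple a b c i ∈ a ∷ b ∷ c ∷ ws
triple-∈ a b c 0F = here refl
triple-∈ a b c 1F = there (here refl)
triple-∈ a b c 2F = there (there (here refl))

triple-injective : {V : Set} {a b c : V} → a ≢ b → a ≢ c → b ≢ c → ∀ i j → triple a b c i ≡ triple a b c j → i ≡ j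
triple-injective ab ac bc 0F 0F _ = refl
triple-injective ab ac bc 0F 1F h = contradiction h ab
triple-injective ab ac bc 0F 2F h = contradiction h ac
triple-injective ab ac bc 1F 0F h = contradiction (sym h) ab
triple-injective ab ac bc 1F 1F _ = refl
triple-injective ab ac bc 1F 2F h = contradiction h bc
triple-injective ab ac bc 2F 0F h = contradiction (sym h) ac
triple-injective ab ac bc 2F 1F h = contradiction (sym h) bc
triple-injective ab ac bc 2F 2F _ = refl

triple-∉ : {V : Set} {a b c : V} {ws : List V} → Unique (a ∷ b ∷ c ∷ ws) → ∀ {x} → x ∈ ws → ∀ i → triple a b c i ≢ x
triple-∉ ((_ ∷ _ ∷ a∉) ∷ _) x∈ 0F = All.lookup a∉ x∈
triple-∉ (_ ∷ (_ ∷ b∉) ∷ _) x∈ 1F = All.lookup b∉ x∈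
triple-∉ (_ ∷ _ ∷ c∉ ∷ _) x∈ 2F = All.lookup c∉ x∈

-- The ends follow the edge order of `edgeColor`.
source target : Fin 3 → Fin 3
source 0F = 0F
source 1F = 1F
source 2F = 0F
target 0F = 1F
target 1F = 2F
target 2F = 2F

edge-determined : ∀ e e′ → SamePair (source e) (target e) (source e′) (target e′) → e ≡ e′
edge-determined 0F 0F _ = refl
edge-determined 1F 1F _ = refl
edge-determined 2F 2F _ = refl
edge-determined 0F 1F (inj₁ ())
edge-determined 0F 1F (inj₂ (() , _))
edge-determined 0F 2F (inj₁ (_ , ()))
edge-determined 0F 2F (inj₂ (() , _))
edge-determined 1F 0F (inj₁ ())
edge-determined 1F 0F (inj₂ (_ , ()))
edge-determined 1F 2F (inj₁ (() , _))
edge-determined 1F 2F (inj₂ (() , _))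
edge-determined 2F 0F (inj₁ (_ , ()))
edge-determined 2F 0F (inj₂ (() , _))
edge-determined 2F 1F (inj₁ (() , _))
edge-determined 2F 1F (inj₂ (() , _))

record Triangles {V : Set} (G : Graph V) (k : ℕ) (vs : List V) : Set where
  open Graph G
  field
    vertex     : Fin k → Fin 3 → V
    vertex-∈   : ∀ t i → vertex t i ∈ vs
    vertex-inj : ∀ t i t′ i′ → vertex t i ≡ vertex t′ i′ → t ≡ t′ × i ≡ i′
    avoids     : ∀ t e → adj (vertex t (source e)) (vertex t (target e)) ≡ 0

module _ {V : Set} {G : Graph V} where
  open Graph G

  factor⇒triangles : ∀ k {vs} → Factor G vs → Unique vs → length vs ≡ k * 3 → Triangles G k vs
  factor⇒triangles zero _ _ _ = record { vertex = λ () ; vertex-∈ = λ () ; vertex-inj = λ () ; avoids = λ () }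
  factor⇒triangles (suc k) {vs} (tri {a = a} {b} {c} {ws} p ab ac bc f) unique len
    with Unique-↭ p unique
  ... | u@((a≢b ∷ a≢c ∷ _) ∷ (b≢c ∷ _) ∷ _ ∷ unique-ws) =
    record { vertex = vertex′ ; vertex-∈ = ∈′ ; vertex-inj = inj′ ; avoids = avoids′ }
    where
    open Triangles (factor⇒triangles k f unique-ws (+-cancelˡ-≡ 3 _ _ (≡-trans (sym (↭-length p)) len)))
    vertex′ : Fin (suc k) → Fin 3 → V
    vertex′ zero = triple a b c
    vertex′ (suc t) = vertex t
    ∈′ : ∀ t i → vertex′ t i ∈ vs
    ∈′ zero i = ∈-resp-↭ (↭-sym p) (triple-∈ a b c i)
    ∈′ (suc t) i = ∈-resp-↭ (↭-sym p) (there (there (there (vertex-∈ t i))))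
    inj′ : ∀ t i t′ i′ → vertex′ t i ≡ vertex′ t′ i′ → t ≡ t′ × i ≡ i′
    inj′ zero i zero i′ h = refl , triple-injective a≢b a≢c b≢c i i′ h
    inj′ zero i (suc t′) i′ h = contradiction h (triple-∉ u (vertex-∈ t′ i′) i)
    inj′ (suc t) i zero i′ h = contradiction (sym h) (triple-∉ u (vertex-∈ t i) i′)
    inj′ (suc t) i (suc t′) i′ h with vertex-inj t i t′ i′ h
    ... | t≡ , i≡ = cong suc t≡ , i≡
    avoids′ : ∀ t e → adj (vertex′ t (source e)) (vertex′ t (target e)) ≡ 0
    avoids′ zero 0F = ab
    avoids′ zero 1F = bc
    avoids′ zero 2F = ac
    avoids′ (suc t) e = avoids t e

-- Representative edges of the colours.

samePair-flip : {V : Set} {i j x y : V} → SamePair i j x y → SamePair j i x y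
samePair-flip (inj₁ (h , h′)) = inj₂ (h′ , h)
samePair-flip (inj₂ (h , h′)) = inj₁ (h′ , h)

samePair-join : {V : Set} {i j k l x y : V} → SamePair i j x y → SamePair k l x y → SamePair i j k l
samePair-join (inj₁ (refl , refl)) (inj₁ (refl , refl)) = inj₁ (refl , refl)
samePair-join (inj₁ (refl , refl)) (inj₂ (refl , refl)) = inj₂ (refl , refl)
samePair-join (inj₂ (refl , refl)) (inj₁ (refl , refl)) = inj₂ (refl , refl)
samePair-join (inj₂ (refl , refl)) (inj₂ (refl , refl)) = inj₁ (refl , refl)

module _ {n m : ℕ} (c : EdgeColoring n m) where

  -- A proof `u` of `UsesAllColors` serves as the choice of a representative edge for every colour.
  Chosen : UsesAllColors c → Fin n → Fin n → Set
  Chosen u i j = SamePair i j (proj₁ (u (col c i j))) (proj₁ (proj₂ (u (col c i j))))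

  -- The diagonal counts as null only to make the rejected edges an irreflexive relation.
  Null : UsesAllColors c → Fin n → Fin n → Set
  Null u i j = i ≡ j ⊎ Chosen u i j

  samePair? : ∀ (i j x y : Fin n) → Dec (SamePair i j x y)
  samePair? i j x y = ((i Fin.≟ x) ×-dec (j Fin.≟ y)) ⊎-dec ((i Fin.≟ y) ×-dec (j Fin.≟ x))

  null? : ∀ u i j → Dec (Null u i j)
  null? u i j = (i Fin.≟ j) ⊎-dec samePair? i j _ _

  null-sym : ∀ u {i j} → Null u i j → Null u j i
  null-sym u (inj₁ h) = inj₁ (sym h)
  null-sym u {i} {j} (inj₂ h) =
    inj₂ (subst (λ a → SamePair j i (proj₁ (u a)) (proj₁ (proj₂ (u a)))) (symm c i j) (samePair-flip h))

  rejected : UsesAllColors c → Graph (Fin n)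
  rejected u = record
    { adj        = λ i j → off (null? u i j)
    ; adj-sym    = λ i j → ≤-antisym (off-mono (null? u i j) (null? u j i) (null-sym u))
                                     (off-mono (null? u j i) (null? u i j) (null-sym u))
    ; adj-irrefl = λ i → off-yes (null? u i i) (inj₁ refl)
    ; adj≤1      = λ i j → off≤1 (null? u i j)
    }

  nulls+edges : ∀ u vs → length (nulls (null? u) vs) + edges (rejected u) vs ≡ choose2 (length vs)
  nulls+edges u [] = refl
  nulls+edges u (v ∷ vs) = begin
    length (map (v ,_) ns ++ nulls (null? u) vs) + (d + e)
      ≡⟨ cong (_+ (d + e)) (≡-trans (length-++ (map (v ,_) ns)) (cong (_+ l) (length-map (v ,_) ns))) ⟩
    length ns + l + (d + e)
      ≡⟨ +-exchange (length ns) l d e ⟩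
    (length ns + d) + (l + e)
      ≡⟨ cong₂ _+_ (length-filter+sum (null? u) v vs) (nulls+edges u vs) ⟩
    length vs + choose2 (length vs) ∎
    where
    open ≡-Reasoning
    ns = filter (null? u v) vs
    l = length (nulls (null? u) vs)
    d = deg (rejected u) v vs
    e = edges (rejected u) vs

  -- A colour is sent to the position of its representative in the list; the pair found there has
  -- that colour, so the map is injective.
  colors≤nulls : ∀ u → m ≤ length (nulls (null? u) (allFin n))
  colors≤nulls u = Fin.injective⇒≤ {f = λ a → Any.index (proj₁ (proj₂ (found a)))} injective
    where
    found : ∀ a → Σ (Fin n × Fin n) λ p → p ∈ nulls (null? u) (allFin n) × col c (proj₁ p) (proj₂ p) ≡ a
    found a with u a in ua
    ... | i , j , i≢j , refl with ∈-nulls (null? u) (null-sym u) (∈-allFin i) (∈-allFin j) i≢j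
              (inj₂ (inj₁ (sym (cong proj₁ ua) , sym (cong (proj₁ ∘ proj₂) ua))))
    ...   | i′ , j′ , ∈ , inj₁ (refl , refl) = (i′ , j′) , ∈ , refl
    ...   | i′ , j′ , ∈ , inj₂ (refl , refl) = (i′ , j′) , ∈ , symm c i′ j′
    injective : ∀ {a b} → Any.index (proj₁ (proj₂ (found a))) ≡ Any.index (proj₁ (proj₂ (found b))) → a ≡ b
    injective {a} {b} eq with found a | found b
    ... | p , p∈ , refl | q , q∈ , refl =
      cong (λ r → col c (proj₁ r) (proj₂ r)) (index-injective (setoid (Fin n × Fin n)) p∈ q∈ eq)

  colors+rejected : ∀ u → m + edges (rejected u) (allFin n) ≤ choose2 n
  colors+rejected u = ≤-trans (+-monoˡ-≤ _ (colors≤nulls u))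
    (≤-reflexive (≡-trans (nulls+edges u (allFin n)) (cong choose2 (length-tabulate {n = n} (λ i → i)))))

  edgeColor-ends : ∀ {k} (f : kC3Copy k n) t e → edgeColor c f t e ≡ col c (emb f t (source e)) (emb f t (target e))
  edgeColor-ends f t 0F = refl
  edgeColor-ends f t 1F = refl
  edgeColor-ends f t 2F = refl

  -- Every edge used is the representative of its colour. Edges of equal colour therefore have the
  -- same ends, and disjointness makes them the same edge of the same triangle.
  triangles⇒rainbow : ∀ {k} u → Triangles (rejected u) k (allFin n) → ¬ NoRainbowkC3 k c
  triangles⇒rainbow {k} u T none = none f rainbow
    where
    open Triangles T
    f : kC3Copy k n
    f = record { emb = vertex ; inj = vertex-inj }
    chosen : ∀ t e → Chosen u (vertex t (source e)) (vertex t (target e))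
    chosen t e with off≡0 (null? u (vertex t (source e)) (vertex t (target e))) (avoids t e)
    ... | inj₂ h = h
    ... | inj₁ h = contradiction (proj₂ (vertex-inj t (source e) t (target e) h)) (ends e)
      where
      ends : ∀ e → source e ≢ target e
      ends 0F ()
      ends 1F ()
      ends 2F ()
    rainbow : IsRainbow c f
    rainbow t e t′ e′ h with samePair-join (chosen t e)
      (subst (λ a → SamePair (vertex t′ (source e′)) (vertex t′ (target e′)) (proj₁ (u a)) (proj₁ (proj₂ (u a))))
        (≡-trans (sym (edgeColor-ends f t′ e′)) (≡-trans (sym h) (edgeColor-ends f t e))) (chosen t′ e′))
    ... | inj₁ (h₁ , h₂) with vertex-inj _ _ _ _ h₁ | vertex-inj _ _ _ _ h₂
    ...   | t≡ , s≡ | _ , t′≡ = t≡ , edge-determined e e′ (inj₁ (s≡ , t′≡))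
    rainbow t e t′ e′ h | inj₂ (h₁ , h₂) with vertex-inj _ _ _ _ h₁ | vertex-inj _ _ _ _ h₂
    ...   | t≡ , s≡ | _ , t′≡ = t≡ , edge-determined e e′ (inj₂ (s≡ , t′≡))

  -- Changing the representative of one colour.

  re-represent : UsesAllColors c → ∀ {v a} → v ≢ a → UsesAllColors c
  re-represent u {v} {a} v≢a b with b Fin.≟ col c v a
  ... | yes b≡ = v , a , v≢a , sym b≡
  ... | no _   = u b

  re-represent-frees : ∀ u {v a} (v≢a : v ≢ a) → Graph.adj (rejected (re-represent u v≢a)) v a ≡ 0
  re-represent-frees u {v} {a} v≢a = off-yes (null? (re-represent u v≢a) v a) (inj₂ chosen)
    where
    chosen : Chosen (re-represent u v≢a) v a
    chosen with col c v a Fin.≟ col c v a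
    ... | yes _  = inj₁ (refl , refl)
    ... | no ¬eq = contradiction refl ¬eq

  -- For the colour of `v a` the only representative is now `v a` itself, and the other colours keep
  -- theirs; so no other pair becomes chosen.
  re-represent-keeps : ∀ u {v a} (v≢a : v ≢ a) {i j} → ¬ SamePair i j v a →
    Graph.adj (rejected u) i j ≤ Graph.adj (rejected (re-represent u v≢a)) i j
  re-represent-keeps u {v} {a} v≢a {i} {j} other =
    off-mono (null? u i j) (null? (re-represent u v≢a) i j) back
    where
    back : Null (re-represent u v≢a) i j → Null u i j
    back (inj₁ h) = inj₁ h
    back (inj₂ h) with col c i j Fin.≟ col c v a
    ... | yes _ = contradiction h other
    ... | no _  = inj₂ h

  -- In both exceptional cases the edge va of G gives its colour away: making va the
  -- representative of its own colour frees the pair v, a and changes nothing else at v and a.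
  rainbow-triangles : ∀ k → n ≡ 6 + k * 3 → UsesAllColors c →
    (∀ u → edges (rejected u) (allFin n) ≤ 3 + k * 3) →
    ∃ λ u → Triangles (rejected u) (2 + k) (allFin n)
  rainbow-triangles k n≡ u few = result (factor-or-exception (rejected u) k len (few u))
    where
    vs : List (Fin n)
    vs = allFin n
    len : length vs ≡ 6 + k * 3
    len = ≡-trans (length-tabulate (λ i → i)) n≡
    triangles : ∀ u → Factor (rejected u) vs → ∃ λ u → Triangles (rejected u) (2 + k) vs
    triangles u f = u , factor⇒triangles (2 + k) f (allFin⁺ n) len
    sparse : ∀ u → 3 + edges (rejected u) vs ≤ length vs
    sparse u = sparse-from (rejected u) vs (3 + k * 3) len (few u)
    distinct : ∀ {v a} → 1 ≤ Graph.adj (rejected u) v a → v ≢ a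
    distinct {v} va refl = contradiction (subst (1 ≤_) (Graph.adj-irrefl (rejected u) v) va) λ ()
    module _ {v a ws} (p : vs ↭ v ∷ a ∷ ws) (v≢a : v ≢ a) where
      u′ = re-represent u v≢a
      away : All (λ x → ¬ SamePair v x v a × ¬ SamePair a x v a) ws
      away with Unique-↭ p (allFin⁺ n)
      ... | (_ ∷ v∉) ∷ a∉ ∷ _ = All.zipWith (λ (v≢x , a≢x) →
              (λ { (inj₁ (_ , x≡a)) → a≢x (sym x≡a) ; (inj₂ (v≡a , _)) → v≢a v≡a }) ,
              (λ { (inj₁ (a≡v , _)) → v≢a (sym a≡v) ; (inj₂ (_ , x≡v)) → v≢x (sym x≡v) })) (v∉ , a∉)
      keeps-v : All (λ x → Graph.adj (rejected u) v x ≤ Graph.adj (rejected u′) v x) ws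
      keeps-v = All.map (re-represent-keeps u v≢a ∘ proj₁) away
      keeps-a : All (λ x → Graph.adj (rejected u) a x ≤ Graph.adj (rejected u′) a x) ws
      keeps-a = All.map (re-represent-keeps u v≢a ∘ proj₂) away
    result : Factor (rejected u) vs ⊎ (k ≡ 0 × TriangleIn (rejected u) vs) ⊎ (k ≡ 1 × HeavyEdgeIn (rejected u) vs) →
      ∃ λ u → Triangles (rejected u) (2 + k) vs
    result (inj₁ f) = triangles u f
    result (inj₂ (inj₁ (refl , v , a , x , ys , p , va , vx , ax))) =
      triangles u₁ (extend (rejected u₁)
        (step-opened-triangle (rejected u₁) (sparse u₁) (few u₁) p (re-represent-frees u v≢a)
          (≤-trans vx (All.head (keeps-v p v≢a))) (≤-trans ax (All.head (keeps-a p v≢a))))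
        len (factor-3 (rejected u₁)))
      where
      v≢a = distinct va
      u₁ = re-represent u v≢a
    result (inj₂ (inj₂ (refl , v , a , ws , p , va , dv , da))) =
      triangles u₁ (extend (rejected u₁)
        (step-opened-heavy-edge (rejected u₁) (sparse u₁) (few u₁) p (re-represent-frees u v≢a)
          (≤-trans dv (sum-mono (keeps-v p v≢a))) (≤-trans da (sum-mono (keeps-a p v≢a))))
        len (factor-6 (rejected u₁)))
      where
      v≢a = distinct va
      u₁ = re-represent u v≢a

-- The upper bound.

choose2≡C : ∀ n → choose2 n ≡ n C 2
choose2≡C zero = refl
choose2≡C (suc n) = ≡-trans (cong₂ _+_ (sym (nC1≡n n)) (choose2≡C n)) (nCk+nC[k+1]≡[n+1]C[k+1] n 1)

-- Two colours beyond `choose2 (n - 1)` leave at most `(n - 1) - 2` rejected edges. This is shown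
-- for every `u`, because the exceptional cases switch to another choice of representatives.
upper-bound : ∀ k m → Admissible (2 + k) (6 + k * 3) m → m ≤ choose2 (5 + k * 3) + 1
upper-bound k m (c , u , none) = ≮⇒≥ λ many →
  let u′ , T = rainbow-triangles c k refl u (few many) in triangles⇒rainbow c u′ T none
  where
  open ≤-Reasoning
  few : choose2 (5 + k * 3) + 1 < m → ∀ u → edges (rejected c u) (allFin (6 + k * 3)) ≤ 3 + k * 3
  few many u = +-cancelʳ-≤ (2 + C) _ _ (begin
    e + (2 + C)          ≡⟨ +-comm e _ ⟩
    2 + C + e            ≡⟨ cong (λ x → suc x + e) (+-comm 1 C) ⟩
    suc (C + 1) + e      ≤⟨ +-monoˡ-≤ e many ⟩
    m + e                ≤⟨ colors+rejected c u ⟩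
    5 + k * 3 + C        ≡⟨ lem (k * 3) C ⟩
    3 + k * 3 + (2 + C)  ∎)
    where
    C = choose2 (5 + k * 3)
    e = edges (rejected c u) (allFin (6 + k * 3))
    lem : ∀ x y → 5 + x + y ≡ 3 + x + (2 + y)
    lem = solve-∀

-- The lower bound.

-- The junk colour stays fixed, and proper colours are shifted past the `n` colours of the edges at
-- the new vertex.
lift-color : ∀ n {x} → Fin (suc x) → Fin (suc (n + x))
lift-color n zero = zero
lift-color n (suc i) = suc (n ↑ʳ i)

-- Colour zero is a junk value, taken only on the diagonal.
all-distinct : ∀ n → Fin n → Fin n → Fin (suc (choose2 n))
all-distinct (suc n) zero    zero    = zero
all-distinct (suc n) zero    (suc j) = suc (j ↑ˡ choose2 n)
all-distinct (suc n) (suc i) zero    = suc (i ↑ˡ choose2 n)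
all-distinct (suc n) (suc i) (suc j) = lift-color n (all-distinct n i j)

all-distinct-sym : ∀ n i j → all-distinct n i j ≡ all-distinct n j i
all-distinct-sym (suc n) zero    zero    = refl
all-distinct-sym (suc n) zero    (suc j) = refl
all-distinct-sym (suc n) (suc i) zero    = refl
all-distinct-sym (suc n) (suc i) (suc j) = cong (lift-color n) (all-distinct-sym n i j)

all-distinct-surjective : ∀ n (a : Fin (choose2 n)) → ∃₂ λ i j → i ≢ j × all-distinct n i j ≡ suc a
all-distinct-surjective (suc n) a with splitAt n a in eq
... | inj₁ j = zero , suc j , (λ ()) , cong suc (Fin.splitAt⁻¹-↑ˡ eq)
... | inj₂ b with all-distinct-surjective n b
...   | i , j , i≢j , h = suc i , suc j , i≢j ∘ Fin.suc-injective ,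
        ≡-trans (cong (lift-color n) h) (cong suc (Fin.splitAt⁻¹-↑ʳ eq))

-- The junk colour of `all-distinct` is reused as the common colour of the edges at vertex zero, so
-- the count is exactly `suc (choose2 n)`.
star : ∀ n → EdgeColoring (suc n) (suc (choose2 n))
star n = record { col = color ; symm = color-sym }
  where
  color : Fin (suc n) → Fin (suc n) → Fin (suc (choose2 n))
  color zero    _       = zero
  color (suc i) zero    = zero
  color (suc i) (suc j) = all-distinct n i j
  color-sym : ∀ i j → color i j ≡ color j i
  color-sym zero    zero    = refl
  color-sym zero    (suc j) = refl
  color-sym (suc i) zero    = refl
  color-sym (suc i) (suc j) = all-distinct-sym n i j

star-uses-all : ∀ n → UsesAllColors (star (suc n))
star-uses-all n zero = zero , suc zero , (λ ()) , refl
star-uses-all n (suc a) with all-distinct-surjective (suc n) a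
... | i , j , i≢j , h = suc i , suc j , i≢j ∘ Fin.suc-injective , h

star-center : ∀ n i → col (star n) i zero ≡ zero
star-center n zero = refl
star-center n (suc i) = refl

-- Pigeonhole: if `y` were missed, `punchOut` would give an injection into a set with one element
-- fewer.
injective⇒hits : ∀ {n} (f : Fin (suc n) → Fin (suc n)) → (∀ {i j} → f i ≡ f j → i ≡ j) → ∀ y → ∃ λ i → f i ≡ y
injective⇒hits f inj y with Fin.any? (λ i → f i Fin.≟ y)
... | yes hit = hit
... | no miss = contradiction
  (Fin.injective⇒≤ {f = λ i → punchOut (avoided i)} (inj ∘ Fin.punchOut-injective (avoided _) (avoided _)))
  (<⇒≱ (n<1+n _))
  where
  avoided : ∀ i → y ≢ f i
  avoided i h = miss (i , sym h)

-- The copy has as many vertices as the complete graph, so it is spanning.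
copy-hits : ∀ k (f : kC3Copy (suc k) (suc k * 3)) y → ∃₂ λ t i → emb f t i ≡ y
copy-hits k f y with injective⇒hits (λ x → emb f (proj₁ (remQuot 3 x)) (proj₂ (remQuot {suc k} 3 x))) injective y
  where
  injective : ∀ {x x′} → emb f (proj₁ (remQuot {suc k} 3 x)) (proj₂ (remQuot {suc k} 3 x)) ≡
    emb f (proj₁ (remQuot {suc k} 3 x′)) (proj₂ (remQuot {suc k} 3 x′)) → x ≡ x′
  injective {x} {x′} h with inj f _ _ _ _ h
  ... | t≡ , i≡ = ≡-trans (sym (Fin.combine-remQuot {suc k} 3 x))
        (≡-trans (cong₂ combine t≡ i≡) (Fin.combine-remQuot {suc k} 3 x′))
... | x , h = proj₁ (remQuot {suc k} 3 x) , proj₂ (remQuot {suc k} 3 x) , h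

-- A spanning copy contains the centre, and the two edges of its triangle at the centre share colour
-- zero.
star-no-rainbow : ∀ k → NoRainbowkC3 (suc k) (star (2 + k * 3))
star-no-rainbow k f rainbow with copy-hits k f zero
... | t , i , h = clash i h
  where
  c = star (2 + k * 3)
  out : ∀ {x} y → x ≡ zero → col c x y ≡ zero
  out y refl = refl
  into : ∀ {x} y → x ≡ zero → col c y x ≡ zero
  into y refl = star-center _ y
  clash : ∀ i → ¬ emb f t i ≡ zero
  clash 0F h with rainbow t 0F t 2F (≡-trans (out _ h) (sym (out _ h)))
  ... | _ , ()
  clash 1F h with rainbow t 0F t 1F (≡-trans (into (emb f t 0F) h) (sym (out (emb f t 2F) h)))
  ... | _ , ()
  clash 2F h with rainbow t 1F t 2F (≡-trans (into (emb f t 1F) h) (sym (into (emb f t 0F) h)))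
  ... | _ , ()

-- Writing the number of triangles as `2 + k` avoids truncated subtraction.
ar-kC3 : ∀ k → ArkC3≡ (2 + k) (6 + k * 3) (choose2 (5 + k * 3) + 1)
ar-kC3 k = subst (Admissible _ _) (+-comm 1 _) (star _ , star-uses-all _ , star-no-rainbow (suc k)) , upper-bound k

theorem1p2 : ∀ (k : ℕ) → 2 ≤ k → ArkC3≡ k (3 * k) (((3 * k ∸ 1) C 2) + 1)
theorem1p2 k@(suc (suc k′)) (s≤s (s≤s _)) =
  subst (λ n → ArkC3≡ k n (((n ∸ 1) C 2) + 1)) (*-comm k 3)
    (subst (λ r → ArkC3≡ k (k * 3) (r + 1)) (choose2≡C (5 + k′ * 3)) (ar-kC3 k′))
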